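{- Let $G=(V,E,w)$ be a finite connected graph with $|V|=n\ge2$ and weights $w:E\to\mathbb{R}_{>0}$. For every connected binary hierarchy $T\in\mathcal T_{\mathrm{conn}}^{\mathrm{bin}}(G)$, $$\frac{\operatorname{cost}_D^-(T)}{F(T)}=\sum_{S\in\mathcal I(T)}\mu_T(S)\rho_T(S)=\mathbb E_{\mu_T}[\rho_T].$$ In particular, if $T_\star\in\mathcal T_{\mathrm{conn}}^{\mathrm{bin}}(G)$ is free optimal, i.e. $F(T_\star)=\operatorname{OPT}_{\mathrm{free}}(G,w)$, then $$\frac{\operatorname{OPT}_{\mathrm{card}}(G,w)}{\operatorname{OPT}_{\mathrm{free}}(G,w)}\le\mathbb E_{\mu_{T_\star}}[\rho_{T_\star}].$$
   Context: $d_G$ is the shortest-path metric of $(V,E)$ with every edge of length $1$ (weights are not lengths); $\operatorname{diam}_{d_G}(S)=\max_{a,b\in S}d_G(a,b)$. A rooted binary hierarchy $T$ on $V$ is a rooted tree whose leaves are the vertices of $V$ and whose internal nodes have exactly two children; each node is identified with the set of leaves below it (a cluster); $C_T(x,y)$ is the cluster of the lowest common ancestor of $x,y$. $\mathcal T_{\mathrm{conn}}^{\mathrm{bin}}(G)$ is the set of rooted binary hierarchies all of whose clusters induce connected subgraphs of $G$. $\mathcal I(T)$ is the family of internal (non-leaf) clusters. For $S\in\mathcal I(T)$ with children $S^0,S^1$: $b_T(S)$ is the total weight of edges with one endpoint in $S^0$ and the other in $S^1$; $\Delta_T(S)=\operatorname{diam}_{d_G}(S)$; $a_T(S)=\Delta_T(S)b_T(S)$;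 $\rho_T(S)=(|S|-1)/\Delta_T(S)$. $F(T)=\sum_{xy\in E}w_{xy}\operatorname{diam}_{d_G}(C_T(x,y))>0$, and $\mu_T(S)=a_T(S)/F(T)$, which is a probability measure on $\mathcal I(T)$. $\operatorname{cost}_D^-(T)=\sum_{xy\in E}w_{xy}(|C_T(x,y)|-1)$. $\operatorname{OPT}_{\mathrm{free}}(G,w)$ is the minimum of $\sum_{xy\in E}w_{xy}u(x,y)$ over all ultrametrics $u$ on $V$ (metrics with $u(x,y)\le\max\{u(x,z),u(z,y)\}$) with $u\ge d_G$ on all pairs. Put $h_H(x,x)=0$, $h_H(x,y)=|C_H(x,y)|-1$ for $x\ne y$; $\operatorname{OPT}_{\mathrm{card}}(G,w)$ is the minimum of $\sum_{xy\in E}w_{xy}h_H(x,y)$ over all rooted binary hierarchies $H$ on $V$ with $h_H\ge d_G$ on all pairs. -}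

module Defs where

open import Algebra.Bundles using (CommutativeRing)
open import Algebra.Definitions using (Invertible)
import Algebra.Definitions.RawMonoid as RawMonoid
open import Data.Bool.Base using (if_then_else_)
open import Data.Empty using (⊥-elim)
open import Data.Fin.Base using (Fin; zero; suc)
import Data.Fin.Base as Fin
import Data.Fin.Properties as Fin
open import Data.Fin.Subset using (Subset; _∈_; _∪_; _∩_; ⁅_⁆; ⊤; ∣_∣; Empty; Nonempty)
open import Data.Fin.Subset.Properties using (_∈?_; ∈⊤; x∈⁅x⁆; x∈p∪q⁺; x∈p∪q⁻; x∈p∩q⁺)
open import Data.List.Base using (List; allFin; filter; cartesianProductWith)
open import Data.List.Extrema.Nat using (max; xs≤max)
open import Data.List.Membership.Propositional.Properties using (∈-allFin; ∈-filter⁺; ∈-cartesianProductWith⁺)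
import Data.List.Relation.Unary.All as All
open import Data.Nat.Base as ℕ using (ℕ; zero; suc; _∸_; z≤n; s≤s)
import Data.Nat.Properties as ℕ
open import Data.Product.Base using (Σ; Σ-syntax; ∃; ∃-syntax; _×_; _,_; proj₁; proj₂)
open import Data.Sum.Base using (_⊎_; inj₁; inj₂; [_,_]′)
open import Data.Vec.Functional using (Vector)
open import Function.Base using (_∘_)
import Function.Metric.Structures as Metric
open import Level using (Level; 0ℓ; _⊔_)
import Level
open import Relation.Binary.Construct.Closure.ReflexiveTransitive using (Star; ε; _◅_)
open import Relation.Binary.Core using (Rel)
open import Relation.Binary.Definitions using (tri<; tri≈; tri>)
open import Relation.Binary.Lattice.Definitions using (Supremum)
open import Relation.Binary.PropositionalEquality.Core as ≡ using (_≡_; _≢_)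
open import Relation.Binary.Structures using (IsStrictPartialOrder)
open import Relation.Nullary.Decidable.Core using (Dec; yes; no; does; _×-dec_; _⊎-dec_)
open import Relation.Nullary.Negation.Core using (¬_)

private
  variable
    n : ℕ

-- The real numbers, axiomatised as a Cauchy-complete Archimedean ordered
-- field.  Classically these axioms characterise ℝ up to isomorphism; they
-- are phrased so that constructive reals satisfy them as well (no
-- decidability of _≈_ or _<_ is assumed, and x ≤ y means ¬ y < x).
record Reals c ℓ₁ ℓ₂ : Set (Level.suc (c ⊔ ℓ₁ ⊔ ℓ₂)) where
  infix 4 _<_ _≤_
  infixr 6 _∨_
  infixl 7 _/_⟨_⟩

  field
    commutativeRing : CommutativeRing c ℓ₁

  open CommutativeRing commutativeRing public hiding (zero)
  open RawMonoid +-rawMonoid public using (sum) renaming (_×_ to _·_)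

  field
    _<_                  : Rel Carrier ℓ₂
    _∨_                  : Carrier → Carrier → Carrier
    isStrictPartialOrder : IsStrictPartialOrder _≈_ _<_

  _≤_ : Rel Carrier ℓ₂
  x ≤ y = ¬ (y < x)

  fromℕ : ℕ → Carrier
  fromℕ k = k · 1#

  Cauchy : (ℕ → Carrier) → Set (c ⊔ ℓ₂)
  Cauchy s = ∀ δ → 0# < δ → ∃[ N ] (∀ i j → N ℕ.≤ i → N ℕ.≤ j → s i < s j + δ)

  _ConvergesTo_ : (ℕ → Carrier) → Carrier → Set (c ⊔ ℓ₂)
  s ConvergesTo l = ∀ δ → 0# < δ → ∃[ N ] (∀ i → N ℕ.≤ i → (s i < l + δ) × (l < s i + δ))

  field
    <-cotrans     : ∀ {x y} → x < y → ∀ z → x < z ⊎ z < y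
    ≤-antisym     : ∀ {x y} → x ≤ y → y ≤ x → x ≈ y
    ∨-supremum    : Supremum _≤_ _∨_
    0<1           : 0# < 1#
    +-monoˡ-<     : ∀ {x y} z → x < y → x + z < y + z
    *-pos         : ∀ {x y} → 0# < x → 0# < y → 0# < x * y
    #0⇒invertible : ∀ {x} → x < 0# ⊎ 0# < x → Invertible _≈_ 1# _*_ x
    archimedean   : ∀ x → ∃[ k ] x < fromℕ k
    complete      : ∀ s → Cauchy s → ∃[ l ] s ConvergesTo l

  open IsStrictPartialOrder isStrictPartialOrder public
    using (<-respʳ-≈; <-respˡ-≈) renaming (irrefl to <-irrefl; trans to <-trans)

  _/_⟨_⟩ : Carrier → (y : Carrier) → 0# < y → Carrier
  x / y ⟨ 0<y ⟩ = x * proj₁ (#0⇒invertible {y} (inj₂ 0<y))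

  IsMinimum : ∀ {a p} {A : Set a} → (A → Set p) → (A → Carrier) → Carrier → Set (a ⊔ p ⊔ ℓ₁ ⊔ ℓ₂)
  IsMinimum {A = A} P f v = (∃[ a ] P a × f a ≈ v) × (∀ a → P a → v ≤ f a)

  <-≤-trans : ∀ {x y z} → x < y → y ≤ z → x < z
  <-≤-trans {z = z} x<y y≤z = [ (λ x<z → x<z) , (λ z<y → ⊥-elim (y≤z z<y)) ]′ (<-cotrans x<y z)

  <⇒≤ : ∀ {x y} → x < y → x ≤ y
  <⇒≤ x<y y<x = <-irrefl refl (<-trans x<y y<x)

  +-pos-nonneg : ∀ {x y} → 0# < x → 0# ≤ y → 0# < x + y
  +-pos-nonneg {x} {y} 0<x 0≤y with <-cotrans (<-respˡ-≈ (+-identityˡ y) (+-monoˡ-< y 0<x)) 0#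
  ... | inj₁ y<0   = ⊥-elim (0≤y y<0)
  ... | inj₂ 0<x+y = 0<x+y

  +-nonneg-pos : ∀ {x y} → 0# ≤ x → 0# < y → 0# < x + y
  +-nonneg-pos 0≤x 0<y = <-respʳ-≈ (+-comm _ _) (+-pos-nonneg 0<y 0≤x)

  +-nonneg : ∀ {x y} → 0# ≤ x → 0# ≤ y → 0# ≤ x + y
  +-nonneg {x} {y} 0≤x 0≤y x+y<0 with <-cotrans x+y<0 x
  ... | inj₂ x<0   = 0≤x x<0
  ... | inj₁ x+y<x = 0≤y (<-respˡ-≈ cancelˡ (<-respʳ-≈ (-‿inverseʳ x) (+-monoˡ-< (- x) x+y<x)))
    where
    cancelˡ : (x + y) + (- x) ≈ y
    cancelˡ = trans (+-congʳ (+-comm x y)) (trans (+-assoc y x (- x)) (trans (+-congˡ (-‿inverseʳ x)) (+-identityʳ y)))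

  sum-nonneg : ∀ {k} (f : Vector Carrier k) → (∀ i → 0# ≤ f i) → 0# ≤ sum f
  sum-nonneg {zero}  f 0≤f = <-irrefl refl
  sum-nonneg {suc k} f 0≤f = +-nonneg (0≤f zero) (sum-nonneg (f ∘ suc) (0≤f ∘ suc))

  sum-pos : ∀ {k} (f : Vector Carrier k) → (∀ i → 0# ≤ f i) → ∀ i → 0# < f i → 0# < sum f
  sum-pos f 0≤f zero    0<fi = +-pos-nonneg 0<fi (sum-nonneg (f ∘ suc) (0≤f ∘ suc))
  sum-pos f 0≤f (suc i) 0<fi = +-nonneg-pos (0≤f zero) (sum-pos (f ∘ suc) (0≤f ∘ suc) i 0<fi)

  fromℕ-pos : ∀ {k} → 1 ℕ.≤ k → 0# < fromℕ k
  fromℕ-pos {suc k} _ = +-pos-nonneg 0<1 (fromℕ-nonneg k)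
    where
    fromℕ-nonneg : ∀ k → 0# ≤ fromℕ k
    fromℕ-nonneg zero    = <-irrefl refl
    fromℕ-nonneg (suc k) = +-nonneg (<⇒≤ 0<1) (fromℕ-nonneg k)

record WeightedGraph {c ℓ₁ ℓ₂} (ℝ : Reals c ℓ₁ ℓ₂) (n : ℕ) : Set (Level.suc 0ℓ ⊔ c ⊔ ℓ₁ ⊔ ℓ₂) where
  open Reals ℝ using (Carrier; _≈_; _<_; 0#)
  infix 4 _~_ _~?_
  field
    _~_      : Rel (Fin n) 0ℓ
    _~?_     : ∀ x y → Dec (x ~ y)
    ~-sym    : ∀ {x y} → x ~ y → y ~ x
    ~-irrefl : ∀ {x} → ¬ (x ~ x)
    w        : ∀ {x y} → x ~ y → Carrier
    -- As e and e′ are arbitrary, this also makes w e independent of the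
    -- proof e of adjacency.
    w-sym    : ∀ {x y} (e : x ~ y) (e′ : y ~ x) → w e ≈ w e′
    w-pos    : ∀ {x y} (e : x ~ y) → 0# < w e

  Connected : Set
  Connected = ∀ x y → Star _~_ x y

  InducesConnected : Subset n → Set
  InducesConnected S = ∀ {x y} → x ∈ S → y ∈ S → Star (λ a b → a ∈ S × b ∈ S × a ~ b) x y

  data Walk : ℕ → Fin n → Fin n → Set where
    []  : ∀ {x} → Walk 0 x x
    _∷_ : ∀ {k x y z} → x ~ y → Walk k y z → Walk (suc k) x z

  walk? : ∀ k x y → Dec (Walk k x y)
  walk? zero x y with x Fin.≟ y
  ... | yes ≡.refl = yes []
  ... | no x≢y     = no λ { [] → x≢y ≡.refl }
  walk? (suc k) x z with Fin.any? (λ y → (x ~? y) ×-dec walk? k y z)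
  ... | yes (y , e , p) = yes (e ∷ p)
  ... | no ∄            = no λ { (e ∷ p) → ∄ (_ , e , p) }

  Star⇒Walk : ∀ {x y} → Star _~_ x y → ∃[ k ] Walk k x y
  Star⇒Walk ε       = 0 , []
  Star⇒Walk (e ◅ s) = _ , e ∷ proj₂ (Star⇒Walk s)

least : ∀ {p} {P : ℕ → Set p} → (∀ k → Dec (P k)) → ∃ P → ∃[ m ] P m × (∀ k → P k → m ℕ.≤ k)
least P? (k , p) = go P? k p
  where
  go : ∀ {p} {P : ℕ → Set p} → (∀ k → Dec (P k)) → ∀ k → P k → ∃[ m ] P m × (∀ k → P k → m ℕ.≤ k)
  go P? zero    p = 0 , p , λ _ _ → z≤n
  go P? (suc k) p with P? 0
  ... | yes p₀ = 0 , p₀ , λ _ _ → z≤n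
  ... | no ¬p₀ with go (P? ∘ suc) k p
  ...   | m , pₘ , min = suc m , pₘ , λ { zero p₀ → ⊥-elim (¬p₀ p₀) ; (suc j) pⱼ → s≤s (min j pⱼ) }

-- Rooted binary hierarchies with leaf set S: the index is the cluster of the
-- root.  Children are stored as an ordered pair, but nothing below depends on
-- their order.
data Hierarchy {n} : Subset n → Set where
  leaf : ∀ x → Hierarchy ⁅ x ⁆
  node : ∀ {S⁰ S¹} → Hierarchy S⁰ → Hierarchy S¹ → Empty (S⁰ ∩ S¹) → Hierarchy (S⁰ ∪ S¹)

AllClusters : (Subset n → Set) → {S : Subset n} → Hierarchy S → Set
AllClusters P {S} (leaf x)     = P S
AllClusters P {S} (node l r _) = P S × AllClusters P l × AllClusters P r

-- The cluster of the lowest common ancestor, meant for x , y ∈ S.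
C : {S : Subset n} → Hierarchy S → Fin n → Fin n → Subset n
C {S = S} (leaf _) x y = S
C {S = S} (node {S⁰} {S¹} l r _) x y =
  if does ((x ∈? S⁰) ×-dec (y ∈? S⁰)) then C l x y else
  if does ((x ∈? S¹) ×-dec (y ∈? S¹)) then C r x y else
  S

-- Internal nodes.  Distinct nodes have distinct clusters, so a sum over
-- internal nodes is a sum over the family of internal clusters.
data ℐ {n} : {S : Subset n} → Hierarchy S → Set where
  root  : ∀ {S⁰ S¹} {l : Hierarchy S⁰} {r : Hierarchy S¹} {dis} → ℐ (node l r dis)
  left  : ∀ {S⁰ S¹} {l : Hierarchy S⁰} {r : Hierarchy S¹} {dis} → ℐ l → ℐ (node l r dis)
  right : ∀ {S⁰ S¹} {l : Hierarchy S⁰} {r : Hierarchy S¹} {dis} → ℐ r → ℐ (node l r dis)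

child⁰ child¹ cluster : {S : Subset n} {T : Hierarchy S} → ℐ T → Subset n
child⁰ (root {S⁰ = S⁰}) = S⁰
child⁰ (left N)         = child⁰ N
child⁰ (right N)        = child⁰ N
child¹ (root {S¹ = S¹}) = S¹
child¹ (left N)         = child¹ N
child¹ (right N)        = child¹ N
cluster N = child⁰ N ∪ child¹ N

Hierarchy-nonempty : {S : Subset n} → Hierarchy S → Nonempty S
Hierarchy-nonempty (leaf x) = x , x∈⁅x⁆ x
Hierarchy-nonempty (node l _ _) with Hierarchy-nonempty l
... | x , x∈S⁰ = x , x∈p∪q⁺ (inj₁ x∈S⁰)

if-elim : ∀ {a b p} {A : Set a} {B : Set b} (P : B → Set p) (A? : Dec A) {t e : B} →
          (A → P t) → P e → P (if does A? then t else e)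
if-elim P (yes x) pt pe = pt x
if-elim P (no _)  pt pe = pe

∈C : {S : Subset n} (T : Hierarchy S) → ∀ {x y} → x ∈ S → y ∈ S → x ∈ C T x y × y ∈ C T x y
∈C (leaf _) x∈S y∈S = x∈S , y∈S
∈C (node {S⁰} {S¹} l r _) {x} {y} x∈S y∈S =
  if-elim P ((x ∈? S⁰) ×-dec (y ∈? S⁰)) (λ (x∈S⁰ , y∈S⁰) → ∈C l x∈S⁰ y∈S⁰)
    (if-elim P ((x ∈? S¹) ×-dec (y ∈? S¹)) (λ (x∈S¹ , y∈S¹) → ∈C r x∈S¹ y∈S¹) (x∈S , y∈S))
  where
  P : Subset _ → Set
  P A = x ∈ A × y ∈ A

children-distinct : {S : Subset n} {T : Hierarchy S} (N : ℐ T) →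
  ∃[ x ] ∃[ y ] x ∈ cluster N × y ∈ cluster N × x ≢ y
children-distinct (root {l = l} {r = r} {dis = dis}) with Hierarchy-nonempty l | Hierarchy-nonempty r
... | x , x∈S⁰ | y , y∈S¹ =
  x , y , x∈p∪q⁺ (inj₁ x∈S⁰) , x∈p∪q⁺ (inj₂ y∈S¹) , λ { ≡.refl → dis (x , x∈p∩q⁺ (x∈S⁰ , y∈S¹)) }
children-distinct (left N)  = children-distinct N
children-distinct (right N) = children-distinct N

module Clustering {c ℓ₁ ℓ₂} (ℝ : Reals c ℓ₁ ℓ₂) {n : ℕ} (2≤n : 2 ℕ.≤ n)
                  (G : WeightedGraph ℝ n) (connected : WeightedGraph.Connected G) where

  open Reals ℝ
  open WeightedGraph G

  d : Fin n → Fin n → ℕ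
  d x y = proj₁ (least (λ k → walk? k x y) (Star⇒Walk (connected x y)))

  elements : Subset n → List (Fin n)
  elements S = filter (_∈? S) (allFin n)

  diam : Subset n → ℕ
  diam S = max 0 (cartesianProductWith d (elements S) (elements S))

  ConnectedHierarchy : Hierarchy (⊤ {n}) → Set
  ConnectedHierarchy = AllClusters InducesConnected

  onEdge : (∀ {x y} → x ~ y → Carrier) → ∀ {x y} → Dec (x Fin.< y) → Dec (x ~ y) → Carrier
  onEdge f (yes _) (yes e) = f e
  onEdge f (yes _) (no _)  = 0#
  onEdge f (no _)  _       = 0#

  -- Each unordered edge is visited once, in the orientation x < y.
  Σᴱ : (∀ {x y} → x ~ y → Carrier) → Carrier
  Σᴱ f = sum λ x → sum λ y → onEdge f (x Fin.<? y) (x ~? y)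

  Σᴵ : {S : Subset n} (T : Hierarchy S) → (ℐ T → Carrier) → Carrier
  Σᴵ (leaf _)     f = 0#
  Σᴵ (node l r _) f = f root + (Σᴵ l (f ∘ left) + Σᴵ r (f ∘ right))

  F : Hierarchy (⊤ {n}) → Carrier
  F T = Σᴱ λ {x} {y} e → w e * fromℕ (diam (C T x y))

  cost⁻ : Hierarchy (⊤ {n}) → Carrier
  cost⁻ T = Σᴱ λ {x} {y} e → w e * fromℕ (∣ C T x y ∣ ∸ 1)

  d-positive : ∀ {x y} → x ≢ y → 1 ℕ.≤ d x y
  d-positive {x} {y} x≢y with least (λ k → walk? k x y) (Star⇒Walk (connected x y))
  ... | zero  , [] , _ = ⊥-elim (x≢y ≡.refl)
  ... | suc _ , _  , _ = s≤s z≤n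

  d≤diam : ∀ {x y} S → x ∈ S → y ∈ S → d x y ℕ.≤ diam S
  d≤diam {x} {y} S x∈S y∈S = All.lookup (xs≤max 0 _)
    (∈-cartesianProductWith⁺ d (∈-filter⁺ (_∈? S) (∈-allFin x) x∈S) (∈-filter⁺ (_∈? S) (∈-allFin y) y∈S))

  ~⇒≢ : ∀ {x y} → x ~ y → x ≢ y
  ~⇒≢ e ≡.refl = ~-irrefl e

  edge-exists : ∃[ x ] ∃[ y ] x Fin.< y × x ~ y
  edge-exists = orient (first (connected x₀ x₁) x₀≢x₁)
    where
    x₀ x₁ : Fin n
    x₀ = Fin.fromℕ< {0} (ℕ.≤-trans (s≤s z≤n) 2≤n)
    x₁ = Fin.fromℕ< {1} 2≤n
    x₀≢x₁ : x₀ ≢ x₁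
    x₀≢x₁ eq with Fin.fromℕ<-injective 0 1 _ _ eq
    ... | ()
    first : ∀ {x y} → Star _~_ x y → x ≢ y → ∃[ z ] x ~ z
    first ε       x≢x = ⊥-elim (x≢x ≡.refl)
    first (e ◅ _) _   = _ , e
    orient : ∀ {x} → ∃[ z ] x ~ z → ∃[ a ] ∃[ b ] a Fin.< b × a ~ b
    orient {x} (z , e) with Fin.<-cmp x z
    ... | tri< x<z _ _ = x , z , x<z , e
    ... | tri≈ _ x≡z _ = ⊥-elim (~⇒≢ e x≡z)
    ... | tri> _ _ z<x = z , x , z<x , ~-sym e

  Σᴱ-pos : (f : ∀ {x y} → x ~ y → Carrier) → (∀ {x y} (e : x ~ y) → 0# < f e) → 0# < Σᴱ f
  Σᴱ-pos f 0<f with edge-exists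
  ... | a , b , a<b , e =
    sum-pos _ (λ x → sum-nonneg _ (λ y → nonneg (x Fin.<? y) (x ~? y))) a
      (sum-pos _ (λ y → nonneg (a Fin.<? y) (a ~? y)) b (pos (a Fin.<? b) (a ~? b)))
    where
    nonneg : ∀ {x y} (p : Dec (x Fin.< y)) (q : Dec (x ~ y)) → 0# ≤ onEdge f p q
    nonneg (yes _) (yes e) = <⇒≤ (0<f e)
    nonneg (yes _) (no _)  = <-irrefl refl
    nonneg (no _)  _       = <-irrefl refl
    pos : (p : Dec (a Fin.< b)) (q : Dec (a ~ b)) → 0# < onEdge f p q
    pos (yes _)  (yes e) = 0<f e
    pos (yes _)  (no ¬e) = ⊥-elim (¬e e)
    pos (no a≮b) _       = ⊥-elim (a≮b a<b)

  F-pos : ∀ T → 0# < F T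
  F-pos T = Σᴱ-pos _ λ {x} {y} e → *-pos (w-pos e) (fromℕ-pos (ℕ.≤-trans (d-positive (~⇒≢ e))
    (d≤diam (C T x y) (proj₁ (∈C T ∈⊤ ∈⊤)) (proj₂ (∈C T ∈⊤ ∈⊤)))))

  module _ (T : Hierarchy (⊤ {n})) where

    b : ℐ T → Carrier
    b S = Σᴱ λ {x} {y} e →
      if does (((x ∈? child⁰ S) ×-dec (y ∈? child¹ S)) ⊎-dec ((x ∈? child¹ S) ×-dec (y ∈? child⁰ S)))
      then w e else 0#

    Δ : ℐ T → ℕ
    Δ S = diam (cluster S)

    Δ-positive : ∀ S → 1 ℕ.≤ Δ S
    Δ-positive S with children-distinct S
    ... | x , y , x∈S , y∈S , x≢y = ℕ.≤-trans (d-positive x≢y) (d≤diam (cluster S) x∈S y∈S)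

    a : ℐ T → Carrier
    a S = fromℕ (Δ S) * b S

    ρ : ℐ T → Carrier
    ρ S = fromℕ (∣ cluster S ∣ ∸ 1) / fromℕ (Δ S) ⟨ fromℕ-pos (Δ-positive S) ⟩

    μ : ℐ T → Carrier
    μ S = a S / F T ⟨ F-pos T ⟩

    -- Expectation of f under the measure on ℐ T with point masses m.
    𝔼 : (m f : ℐ T → Carrier) → Carrier
    𝔼 m f = Σᴵ T λ S → m S * f S

  IsUltrametric : (Fin n → Fin n → Carrier) → Set (c ⊔ ℓ₁ ⊔ ℓ₂)
  IsUltrametric = Metric.IsGeneralMetric _≡_ _≈_ _≤_ 0# _∨_

  FreeFeasible : (Fin n → Fin n → Carrier) → Set (c ⊔ ℓ₁ ⊔ ℓ₂)
  FreeFeasible u = IsUltrametric u × (∀ x y → fromℕ (d x y) ≤ u x y)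

  IsOPT-free : Carrier → Set (c ⊔ ℓ₁ ⊔ ℓ₂)
  IsOPT-free = IsMinimum FreeFeasible λ u → Σᴱ λ {x} {y} e → w e * u x y

  h : Hierarchy (⊤ {n}) → Fin n → Fin n → ℕ
  h H x y = if does (x Fin.≟ y) then 0 else ∣ C H x y ∣ ∸ 1

  CardFeasible : Hierarchy (⊤ {n}) → Set
  CardFeasible H = ∀ x y → d x y ℕ.≤ h H x y

  IsOPT-card : Carrier → Set (ℓ₁ ⊔ ℓ₂)
  IsOPT-card = IsMinimum CardFeasible λ H → Σᴱ λ {x} {y} e → w e * fromℕ (h H x y)

  OPT-free-pos : ∀ {v} → IsOPT-free v → 0# < v
  OPT-free-pos ((u , (_ , d≤u) , cost≈v) , _) = <-respʳ-≈ cost≈v (Σᴱ-pos _ λ e →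
    *-pos (w-pos e) (<-≤-trans (fromℕ-pos (d-positive (~⇒≢ e))) (d≤u _ _)))

{-# OPTIONS --safe #-}

-- The weight of an edge xy is counted in b_T(S) for exactly one internal
-- cluster, S = C_T(x,y).  Exchanging the two sums therefore gives
-- cost_D⁻(T) = Σ_S (|S| - 1) b_T(S), and (|S| - 1) b_T(S) = μ_T(S) ρ_T(S) F(T).
-- For the upper bound, a connected cluster S has diameter at most |S| - 1, so
-- a connected hierarchy is a competitor in the definition of OPT_card.

module Submission where

open import Defs
import Algebra.Properties.CommutativeSemigroup as CommutativeSemigroupProperties
import Algebra.Properties.Semiring.Sum as SemiringSum
open import Data.Bool.Base using (if_then_else_)
open import Data.Fin.Base using (Fin)
import Data.Fin.Base as Fin
import Data.Fin.Properties as Fin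
open import Data.Fin.Subset using (Subset; _∈_; _∉_; _⊆_; _∪_; _-_; ∣_∣; ⊤)
open import Data.Fin.Subset.Properties
  using (_∈?_; ∈⊤; x∈⁅y⁆⇒x≡y; p⊆p∪q; q⊆p∪q; x∈p∪q⁻; x∈p∩q⁺; x∈p∧x≢y⇒x∈p-y; x∈p⇒∣p-x∣<∣p∣)
open import Data.Nat.Base as ℕ using (ℕ; zero; suc; _∸_) renaming (_≤_ to _≤ᴺ_)
import Data.Nat.Properties as ℕ
open import Data.Product.Base using (∃-syntax; _×_; _,_; proj₁; proj₂)
open import Data.Sum.Base using (_⊎_; inj₁; inj₂)
open import Function.Base using (_∘_)
open import Relation.Binary.Construct.Closure.ReflexiveTransitive using (Star; ε; _◅_)
open import Relation.Binary.PropositionalEquality.Core as ≡ using (_≡_; _≢_)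
import Relation.Binary.Reasoning.Setoid as SetoidReasoning
open import Relation.Nullary.Decidable.Core using (Dec; yes; no; does; _×-dec_; _⊎-dec_)
open import Relation.Nullary.Negation.Core using (¬_; contradiction)

-- Conditionals on decidable propositions.

if-yes : ∀ {a p} {A : Set a} {P : Set p} (P? : Dec P) {t e : A} → P → (if does P? then t else e) ≡ t
if-yes (yes _) p = ≡.refl
if-yes (no ¬p) p = contradiction p ¬p

if-no : ∀ {a p} {A : Set a} {P : Set p} (P? : Dec P) {t e : A} → ¬ P → (if does P? then t else e) ≡ e
if-no (yes p) ¬p = contradiction p ¬p
if-no (no _)  ¬p = ≡.refl

-- Clusters of a hierarchy and the pairs they split.

module _ {n : ℕ} where

  cluster⊆ : {S : Subset n} {T : Hierarchy S} (N : ℐ T) → cluster N ⊆ S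
  cluster⊆ root                          = λ x∈ → x∈
  cluster⊆ (left {S¹ = S¹} N)            = p⊆p∪q S¹ ∘ cluster⊆ N
  cluster⊆ (right {S⁰ = S⁰} {S¹ = S¹} N) = q⊆p∪q S⁰ S¹ ∘ cluster⊆ N

  Splits : {S : Subset n} {T : Hierarchy S} → ℐ T → Fin n → Fin n → Set
  Splits N x y = (x ∈ child⁰ N × y ∈ child¹ N) ⊎ (x ∈ child¹ N × y ∈ child⁰ N)

  -- Has the same form as the test inside `b`, so that `b` unfolds to an edge sum of conditionals on
  -- `splits?`.
  splits? : {S : Subset n} {T : Hierarchy S} (N : ℐ T) → ∀ x y → Dec (Splits N x y)
  splits? N x y = ((x ∈? child⁰ N) ×-dec (y ∈? child¹ N)) ⊎-dec ((x ∈? child¹ N) ×-dec (y ∈? child⁰ N))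

  splits⇒∈ : {S : Subset n} {T : Hierarchy S} (N : ℐ T) → ∀ {x y} → Splits N x y → x ∈ S × y ∈ S
  splits⇒∈ N (inj₁ (x∈ , y∈)) = cluster⊆ N (p⊆p∪q _ x∈) , cluster⊆ N (q⊆p∪q (child⁰ N) _ y∈)
  splits⇒∈ N (inj₂ (x∈ , y∈)) = cluster⊆ N (q⊆p∪q (child⁰ N) _ x∈) , cluster⊆ N (p⊆p∪q _ y∈)

  -- Each branch of `C` ends in the cluster of some node; the default branch returns the cluster of
  -- the current root.
  AllClusters-C : ∀ {P : Subset n → Set} {S} (T : Hierarchy S) → AllClusters P T → ∀ x y → P (C T x y)
  AllClusters-C         (leaf _)               p             x y = p
  AllClusters-C {P = P} (node {S⁰} {S¹} l r _) (p , pˡ , pʳ) x y =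
    if-elim P ((x ∈? S⁰) ×-dec (y ∈? S⁰)) (λ _ → AllClusters-C l pˡ x y)
      (if-elim P ((x ∈? S¹) ×-dec (y ∈? S¹)) (λ _ → AllClusters-C r pʳ x y) p)

-- Order and division in the reals.

module RealProperties {c ℓ₁ ℓ₂} (ℝ : Reals c ℓ₁ ℓ₂) where

  open Reals ℝ
  open SetoidReasoning setoid

  -- Positivity of `(y - x) * z` follows from `*-pos`; adding `x * z` to both sides gives the claim.
  *-monoˡ-< : ∀ {x y z} → 0# < z → x < y → x * z < y * z
  *-monoˡ-< {x} {y} {z} 0<z x<y =
    <-respˡ-≈ (+-identityˡ (x * z)) (<-respʳ-≈ cancel
      (+-monoˡ-< (x * z) (*-pos (<-respˡ-≈ (-‿inverseʳ x) (+-monoˡ-< (- x) x<y)) 0<z)))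
    where
    cancel : (y + (- x)) * z + x * z ≈ y * z
    cancel = begin
      (y + (- x)) * z + x * z ≈⟨ distribʳ z (y + (- x)) x ⟨
      ((y + (- x)) + x) * z   ≈⟨ *-congʳ (+-assoc y (- x) x) ⟩
      (y + ((- x) + x)) * z   ≈⟨ *-congʳ (+-congˡ (-‿inverseˡ x)) ⟩
      (y + 0#) * z            ≈⟨ *-congʳ (+-identityʳ y) ⟩
      y * z                   ∎

  x/y*y≈x : ∀ x {y} (0<y : 0# < y) → (x / y ⟨ 0<y ⟩) * y ≈ x
  x/y*y≈x x {y} 0<y = begin
    (x * y⁻¹) * y ≈⟨ *-assoc x y⁻¹ y ⟩
    x * (y⁻¹ * y) ≈⟨ *-congˡ (proj₁ (proj₂ (#0⇒invertible (inj₂ 0<y)))) ⟩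
    x * 1#        ≈⟨ *-identityʳ x ⟩
    x             ∎
    where y⁻¹ = proj₁ (#0⇒invertible (inj₂ 0<y))

  -- Since `≤` is a negated `<`, it suffices to refute `q < x / y`: multiplied by `y`, it would give
  -- `q * y < x`.
  x≤q*y⇒x/y≤q : ∀ {x y q} (0<y : 0# < y) → x ≤ q * y → x / y ⟨ 0<y ⟩ ≤ q
  x≤q*y⇒x/y≤q {x} 0<y x≤q*y q<x/y = x≤q*y (<-respʳ-≈ (x/y*y≈x x 0<y) (*-monoˡ-< 0<y q<x/y))

  x≈q*y⇒x/y≈q : ∀ {x y q} (0<y : 0# < y) → x ≈ q * y → x / y ⟨ 0<y ⟩ ≈ q
  x≈q*y⇒x/y≈q {x} {y} {q} 0<y x≈q*y = begin
    x * y⁻¹       ≈⟨ *-congʳ x≈q*y ⟩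
    (q * y) * y⁻¹ ≈⟨ *-assoc q y y⁻¹ ⟩
    q * (y * y⁻¹) ≈⟨ *-congˡ (proj₂ (proj₂ (#0⇒invertible (inj₂ 0<y)))) ⟩
    q * 1#        ≈⟨ *-identityʳ q ⟩
    q             ∎
    where y⁻¹ = proj₁ (#0⇒invertible (inj₂ 0<y))

-- Short walks inside a connected vertex set.

module GraphProperties {c ℓ₁ ℓ₂} {ℝ : Reals c ℓ₁ ℓ₂} {n : ℕ} (G : WeightedGraph ℝ n) where

  open WeightedGraph G

  StarIn : Subset n → Fin n → Fin n → Set
  StarIn S = Star (λ a b → a ∈ S × b ∈ S × a ~ b)

  -- The recursion treats the tail first. If the tail is already cut, the cut is kept. If it avoids
  -- `x`, then the current vertex is either the last visit to `x` or one more vertex of a path in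
  -- `S - x`.
  lastVisit : ∀ {S u y} x → u ∈ S → StarIn S u y →
              (u ≢ x × StarIn (S - x) u y) ⊎
              (x ≡ y ⊎ ∃[ z ] x ~ z × z ∈ S - x × StarIn (S - x) z y)
  lastVisit {u = u} x u∈S ε with u Fin.≟ x
  ... | yes ≡.refl = inj₂ (inj₁ ≡.refl)
  ... | no u≢x     = inj₁ (u≢x , ε)
  lastVisit {u = u} x u∈S ((_ , v∈S , e) ◅ p) with lastVisit x v∈S p
  ... | inj₂ cut       = inj₂ cut
  ... | inj₁ (v≢x , q) with u Fin.≟ x
  ...   | yes ≡.refl = inj₂ (inj₂ (_ , e , x∈p∧x≢y⇒x∈p-y v∈S v≢x , q))
  ...   | no u≢x     = inj₁ (u≢x , (x∈p∧x≢y⇒x∈p-y u∈S u≢x , x∈p∧x≢y⇒x∈p-y v∈S v≢x , e) ◅ q)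

  -- Cutting the path after its last visit to x frees x, so each step of the walk
  -- uses up one vertex of S.
  StarIn⇒Walk : ∀ {S x y} → x ∈ S → StarIn S x y → ∃[ k ] Walk k x y × k ℕ.< ∣ S ∣
  StarIn⇒Walk {S} x∈S p = go ∣ S ∣ ℕ.≤-refl x∈S p
    where
    -- `S - x` is not a structural part of `S`, so the recursion runs on a bound `m` for the number
    -- of vertices.
    go : ∀ m {S x y} → ∣ S ∣ ≤ᴺ m → x ∈ S → StarIn S x y → ∃[ k ] Walk k x y × k ℕ.< ∣ S ∣
    go zero    ∣S∣≤0 x∈S p = contradiction (ℕ.<-≤-trans (x∈p⇒∣p-x∣<∣p∣ x∈S) ∣S∣≤0) λ ()
    go (suc m) {x = x} ∣S∣≤1+m x∈S p with lastVisit x x∈S p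
    -- The path starts at `x`, so it cannot avoid `x`.
    ... | inj₁ (x≢x , _)                  = contradiction ≡.refl x≢x
    ... | inj₂ (inj₁ ≡.refl)              = 0 , [] , ℕ.≤-<-trans ℕ.z≤n (x∈p⇒∣p-x∣<∣p∣ x∈S)
    ... | inj₂ (inj₂ (z , e , z∈S-x , q)) =
      let ∣S-x∣<∣S∣       = x∈p⇒∣p-x∣<∣p∣ x∈S
          k , ws , k<∣S-x∣ = go m (ℕ.≤-pred (ℕ.≤-trans ∣S-x∣<∣S∣ ∣S∣≤1+m)) z∈S-x q
      -- The bound `k < ∣S - x∣` means `suc k ≤ ∣S - x∣`, which leaves room for the edge `e`.
      in suc k , e ∷ ws , ℕ.≤-<-trans k<∣S-x∣ ∣S-x∣<∣S∣

module ClusteringProperties {c ℓ₁ ℓ₂} (ℝ : Reals c ℓ₁ ℓ₂) {n : ℕ} (2≤n : 2 ≤ᴺ n)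
                            (G : WeightedGraph ℝ n) (connected : WeightedGraph.Connected G) where

  open Reals ℝ
  open WeightedGraph G
  open Clustering ℝ 2≤n G connected
  open RealProperties ℝ
  open GraphProperties G
  open SetoidReasoning setoid
  open SemiringSum semiring using (sum-cong-≋; ∑-distrib-+; *-distribˡ-sum; sum-replicate-zero)
  open CommutativeSemigroupProperties *-commutativeSemigroup using (xy∙z≈xz∙y)

  -- Linearity and interchange of sums over edges and internal nodes.

  EdgeFunction : Set c
  EdgeFunction = ∀ {x y} → x ~ y → Carrier

  Σᴱ-cong : (f g : EdgeFunction) → (∀ {x y} (e : x ~ y) → f e ≈ g e) → Σᴱ f ≈ Σᴱ g
  Σᴱ-cong f g f≈g = sum-cong-≋ λ x → sum-cong-≋ λ y → onEdge-cong (x Fin.<? y) (x ~? y)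
    where
    onEdge-cong : ∀ {x y} (p : Dec (x Fin.< y)) (q : Dec (x ~ y)) → onEdge f p q ≈ onEdge g p q
    onEdge-cong (yes _) (yes e) = f≈g e
    onEdge-cong (yes _) (no _)  = refl
    onEdge-cong (no _)  _       = refl

  Σᴱ-zero : Σᴱ (λ _ → 0#) ≈ 0#
  Σᴱ-zero = trans (sum-cong-≋ λ x → trans (sum-cong-≋ λ y → onEdge-zero (x Fin.<? y) (x ~? y)) (sum-replicate-zero n))
                  (sum-replicate-zero n)
    where
    onEdge-zero : ∀ {x y} (p : Dec (x Fin.< y)) (q : Dec (x ~ y)) → onEdge (λ _ → 0#) p q ≈ 0#
    onEdge-zero (yes _) (yes _) = refl
    onEdge-zero (yes _) (no _)  = refl
    onEdge-zero (no _)  _       = refl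

  Σᴱ-+ : (f g : EdgeFunction) → Σᴱ (λ e → f e + g e) ≈ Σᴱ f + Σᴱ g
  Σᴱ-+ f g = trans
    (sum-cong-≋ λ x → trans (sum-cong-≋ λ y → onEdge-+ (x Fin.<? y) (x ~? y)) (∑-distrib-+ {n} _ _))
    (∑-distrib-+ {n} _ _)
    where
    onEdge-+ : ∀ {x y} (p : Dec (x Fin.< y)) (q : Dec (x ~ y)) →
               onEdge (λ e → f e + g e) p q ≈ onEdge f p q + onEdge g p q
    onEdge-+ (yes _) (yes _) = refl
    onEdge-+ (yes _) (no _)  = sym (+-identityˡ 0#)
    onEdge-+ (no _)  _       = sym (+-identityˡ 0#)

  *-distribˡ-Σᴱ : ∀ z (f : EdgeFunction) → z * Σᴱ f ≈ Σᴱ (λ e → z * f e)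
  *-distribˡ-Σᴱ z f = trans (*-distribˡ-sum {n} z _)
    (sum-cong-≋ λ x → trans (*-distribˡ-sum {n} z _) (sum-cong-≋ λ y → *-onEdge (x Fin.<? y) (x ~? y)))
    where
    *-onEdge : ∀ {x y} (p : Dec (x Fin.< y)) (q : Dec (x ~ y)) →
               z * onEdge f p q ≈ onEdge (λ e → z * f e) p q
    *-onEdge (yes _) (yes _) = refl
    *-onEdge (yes _) (no _)  = zeroʳ z
    *-onEdge (no _)  _       = zeroʳ z

  Σᴵ-cong : ∀ {S} (T : Hierarchy S) {f g : ℐ T → Carrier} → (∀ N → f N ≈ g N) → Σᴵ T f ≈ Σᴵ T g
  Σᴵ-cong (leaf _)     f≈g = refl
  Σᴵ-cong (node l r _) f≈g = +-cong (f≈g root) (+-cong (Σᴵ-cong l (f≈g ∘ left)) (Σᴵ-cong r (f≈g ∘ right)))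

  Σᴵ-zero : ∀ {S} (T : Hierarchy S) {f : ℐ T → Carrier} → (∀ N → f N ≈ 0#) → Σᴵ T f ≈ 0#
  Σᴵ-zero (leaf _)         f≈0 = refl
  Σᴵ-zero (node l r _) {f} f≈0 = begin
    f root + (Σᴵ l (f ∘ left) + Σᴵ r (f ∘ right))
      ≈⟨ +-cong (f≈0 root) (+-cong (Σᴵ-zero l (f≈0 ∘ left)) (Σᴵ-zero r (f≈0 ∘ right))) ⟩
    0# + (0# + 0#) ≈⟨ +-identityˡ (0# + 0#) ⟩
    0# + 0#        ≈⟨ +-identityˡ 0# ⟩
    0#             ∎

  *-distribʳ-Σᴵ : ∀ {S} (T : Hierarchy S) (f : ℐ T → Carrier) z → Σᴵ T f * z ≈ Σᴵ T (λ N → f N * z)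
  *-distribʳ-Σᴵ (leaf _)     f z = zeroˡ z
  *-distribʳ-Σᴵ (node l r _) f z = trans (distribʳ z _ _) (+-congˡ (trans (distribʳ z _ _)
    (+-cong (*-distribʳ-Σᴵ l (f ∘ left) z) (*-distribʳ-Σᴵ r (f ∘ right) z))))

  -- Induction on the hierarchy: each node adds one summand, which additivity of `Σᴱ` splits off.
  Σᴱ-Σᴵ-comm : ∀ {S} (T : Hierarchy S) (f : ℐ T → EdgeFunction) →
               Σᴱ (λ e → Σᴵ T (λ N → f N e)) ≈ Σᴵ T (λ N → Σᴱ (f N))
  Σᴱ-Σᴵ-comm (leaf _)     f = Σᴱ-zero
  Σᴱ-Σᴵ-comm (node l r _) f = begin
    Σᴱ (λ e → f root e + (L e + R e)) ≈⟨ Σᴱ-+ (f root) (λ e → L e + R e) ⟩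
    Σᴱ (f root) + Σᴱ (λ e → L e + R e) ≈⟨ +-congˡ (Σᴱ-+ L R) ⟩
    Σᴱ (f root) + (Σᴱ L + Σᴱ R)
      ≈⟨ +-congˡ (+-cong (Σᴱ-Σᴵ-comm l (λ N → f (left N))) (Σᴱ-Σᴵ-comm r (λ N → f (right N)))) ⟩
    Σᴱ (f root) + (Σᴵ l (λ N → Σᴱ (f (left N))) + Σᴵ r (λ N → Σᴱ (f (right N)))) ∎
    where
    L R : EdgeFunction
    L e = Σᴵ l (λ N → f (left N) e)
    R e = Σᴵ r (λ N → f (right N) e)

  -- Every edge is split at exactly one internal node.

  module _ (g : Subset n → Carrier) (v : Carrier) where

    -- The contribution of one edge to the summand at `N`. Its weight is abstracted to `v`, so that
    -- the lemmas below concern a fixed pair of vertices.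
    term : ∀ {S} {T : Hierarchy S} → Fin n → Fin n → ℐ T → Carrier
    term x y N = g (cluster N) * (if does (splits? N x y) then v else 0#)

    term-unsplit : ∀ {S} {T : Hierarchy S} {x y} (N : ℐ T) → ¬ Splits N x y → term x y N ≈ 0#
    term-unsplit {x = x} {y} N ¬split =
      trans (*-congˡ (reflexive (if-no (splits? N x y) ¬split))) (zeroʳ _)

    term-split : ∀ {S} {T : Hierarchy S} {x y} (N : ℐ T) → Splits N x y → term x y N ≈ g (cluster N) * v
    term-split {x = x} {y} N split = *-congˡ (reflexive (if-yes (splits? N x y) split))

    -- A node that splits a pair contains both vertices in its cluster, hence in `S`.
    Σᴵ-term-outside : ∀ {S} (T : Hierarchy S) {x y} → ¬ (x ∈ S × y ∈ S) → Σᴵ T (term x y) ≈ 0#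
    Σᴵ-term-outside T ∉S = Σᴵ-zero T λ N → term-unsplit N (∉S ∘ splits⇒∈ N)

    -- The proof descends along the recursion of `C`. If the root separates `x` from `y`, both
    -- subtrees contribute zero; otherwise one subtree contains both vertices, and the root and the
    -- other subtree contribute zero.
    Σᴵ-term : ∀ {S} (T : Hierarchy S) {x y} → x ≢ y → x ∈ S → y ∈ S →
              Σᴵ T (term x y) ≈ g (C T x y) * v
    Σᴵ-term (leaf z) x≢y x∈ y∈ =
      contradiction (≡.trans (x∈⁅y⁆⇒x≡y z x∈) (≡.sym (x∈⁅y⁆⇒x≡y z y∈))) x≢y
    Σᴵ-term T@(node {S⁰} {S¹} l r dis) {x} {y} x≢y x∈ y∈ = cases (x∈p∪q⁻ S⁰ S¹ x∈) (x∈p∪q⁻ S⁰ S¹ y∈)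
      where
      exclusive : ∀ {z} → z ∈ S⁰ → z ∉ S¹
      exclusive z∈S⁰ z∈S¹ = dis (_ , x∈p∩q⁺ (z∈S⁰ , z∈S¹))

      -- The two tests of `C` at this node, in the form in which `C` evaluates them.
      both⁰? = (x ∈? S⁰) ×-dec (y ∈? S⁰)
      both¹? = (x ∈? S¹) ×-dec (y ∈? S¹)

      g-C : ∀ {A} → C T x y ≡ A → g A * v ≈ g (C T x y) * v
      g-C eq = *-congʳ (reflexive (≡.cong g (≡.sym eq)))

      atRoot : Splits {T = T} root x y → ¬ (x ∈ S⁰ × y ∈ S⁰) → ¬ (x ∈ S¹ × y ∈ S¹) →
               Σᴵ T (term x y) ≈ g (C T x y) * v
      atRoot split ¬both⁰ ¬both¹ = begin
        term {T = T} x y root + (Σᴵ l (term x y) + Σᴵ r (term x y))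
          ≈⟨ +-cong (term-split {T = T} root split) (+-cong (Σᴵ-term-outside l ¬both⁰) (Σᴵ-term-outside r ¬both¹)) ⟩
        g (S⁰ ∪ S¹) * v + (0# + 0#) ≈⟨ +-congˡ (+-identityˡ 0#) ⟩
        g (S⁰ ∪ S¹) * v + 0#        ≈⟨ +-identityʳ _ ⟩
        g (S⁰ ∪ S¹) * v             ≈⟨ g-C (≡.trans (if-no both⁰? ¬both⁰) (if-no both¹? ¬both¹)) ⟩
        g (C T x y) * v             ∎

      cases : x ∈ S⁰ ⊎ x ∈ S¹ → y ∈ S⁰ ⊎ y ∈ S¹ → Σᴵ T (term x y) ≈ g (C T x y) * v
      cases (inj₁ x∈S⁰) (inj₂ y∈S¹) =
        atRoot (inj₁ (x∈S⁰ , y∈S¹)) (λ p → exclusive (proj₂ p) y∈S¹) (λ p → exclusive x∈S⁰ (proj₁ p))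
      cases (inj₂ x∈S¹) (inj₁ y∈S⁰) =
        atRoot (inj₂ (x∈S¹ , y∈S⁰)) (λ p → exclusive (proj₁ p) x∈S¹) (λ p → exclusive y∈S⁰ (proj₂ p))
      cases (inj₁ x∈S⁰) (inj₁ y∈S⁰) = begin
        term {T = T} x y root + (Σᴵ l (term x y) + Σᴵ r (term x y))
          ≈⟨ +-cong (term-unsplit {T = T} root λ { (inj₁ p) → exclusive y∈S⁰ (proj₂ p)
                                                 ; (inj₂ p) → exclusive x∈S⁰ (proj₁ p) })
                    (+-cong (Σᴵ-term l x≢y x∈S⁰ y∈S⁰) (Σᴵ-term-outside r ¬both¹)) ⟩
        0# + (g (C l x y) * v + 0#) ≈⟨ +-identityˡ _ ⟩
        g (C l x y) * v + 0#        ≈⟨ +-identityʳ _ ⟩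
        g (C l x y) * v             ≈⟨ g-C (if-yes both⁰? (x∈S⁰ , y∈S⁰)) ⟩
        g (C T x y) * v             ∎
        where
        ¬both¹ : ¬ (x ∈ S¹ × y ∈ S¹)
        ¬both¹ p = exclusive x∈S⁰ (proj₁ p)
      cases (inj₂ x∈S¹) (inj₂ y∈S¹) = begin
        term {T = T} x y root + (Σᴵ l (term x y) + Σᴵ r (term x y))
          ≈⟨ +-cong (term-unsplit {T = T} root λ { (inj₁ p) → exclusive (proj₁ p) x∈S¹
                                                 ; (inj₂ p) → exclusive (proj₂ p) y∈S¹ })
                    (+-cong (Σᴵ-term-outside l ¬both⁰) (Σᴵ-term r x≢y x∈S¹ y∈S¹)) ⟩
        0# + (0# + g (C r x y) * v) ≈⟨ +-identityˡ _ ⟩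
        0# + g (C r x y) * v        ≈⟨ +-identityˡ _ ⟩
        g (C r x y) * v             ≈⟨ g-C (≡.trans (if-no both⁰? ¬both⁰) (if-yes both¹? (x∈S¹ , y∈S¹))) ⟩
        g (C T x y) * v             ∎
        where
        ¬both⁰ : ¬ (x ∈ S⁰ × y ∈ S⁰)
        ¬both⁰ p = exclusive (proj₁ p) x∈S¹

  -- The cost as an expectation.

  Σᴱ-C≈Σᴵ-b : ∀ T (g : Subset n → Carrier) →
              Σᴱ (λ {x} {y} e → w e * g (C T x y)) ≈ Σᴵ T (λ S → g (cluster S) * b T S)
  Σᴱ-C≈Σᴵ-b T g = begin
    Σᴱ (λ {x} {y} e → w e * g (C T x y))
      ≈⟨ Σᴱ-cong _ _ (λ {x} {y} e → sym (trans (Σᴵ-term g (w e) T (~⇒≢ e) ∈⊤ ∈⊤) (*-comm (g (C T x y)) (w e)))) ⟩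
    Σᴱ (λ {x} {y} e → Σᴵ T (term g (w e) x y))
      ≈⟨ Σᴱ-Σᴵ-comm T (λ S {x} {y} e → term g (w e) x y S) ⟩
    Σᴵ T (λ S → Σᴱ (λ {x} {y} e → term g (w e) x y S))
      ≈⟨ Σᴵ-cong T (λ S → sym (*-distribˡ-Σᴱ (g (cluster S))
           (λ {x} {y} e → if does (splits? S x y) then w e else 0#))) ⟩
    Σᴵ T (λ S → g (cluster S) * b T S) ∎

  -- `F T` cancels the denominator of `μ`, and the factor `Δ` of `a` cancels the denominator of `ρ`.
  μ*ρ*F : ∀ T S → (μ T S * ρ T S) * F T ≈ fromℕ (∣ cluster S ∣ ∸ 1) * b T S
  μ*ρ*F T S = begin
    (μ T S * ρ T S) * F T     ≈⟨ xy∙z≈xz∙y (μ T S) (ρ T S) (F T) ⟩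
    (μ T S * F T) * ρ T S     ≈⟨ *-congʳ (x/y*y≈x (a T S) (F-pos T)) ⟩
    (Δℝ * b T S) * ρ T S      ≈⟨ *-comm (Δℝ * b T S) (ρ T S) ⟩
    ρ T S * (Δℝ * b T S)      ≈⟨ *-assoc (ρ T S) Δℝ (b T S) ⟨
    (ρ T S * Δℝ) * b T S      ≈⟨ *-congʳ (x/y*y≈x (fromℕ (∣ cluster S ∣ ∸ 1)) (fromℕ-pos (Δ-positive T S))) ⟩
    fromℕ (∣ cluster S ∣ ∸ 1) * b T S ∎
    where Δℝ = fromℕ (Δ T S)

  cost⁻≈𝔼*F : ∀ T → cost⁻ T ≈ 𝔼 T (μ T) (ρ T) * F T
  cost⁻≈𝔼*F T = begin
    cost⁻ T                                              ≈⟨ Σᴱ-C≈Σᴵ-b T (λ A → fromℕ (∣ A ∣ ∸ 1)) ⟩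
    Σᴵ T (λ S → fromℕ (∣ cluster S ∣ ∸ 1) * b T S)       ≈⟨ Σᴵ-cong T (μ*ρ*F T) ⟨
    Σᴵ T (λ S → (μ T S * ρ T S) * F T)                   ≈⟨ *-distribʳ-Σᴵ T (λ S → μ T S * ρ T S) (F T) ⟨
    𝔼 T (μ T) (ρ T) * F T                                ∎

  -- Connected hierarchies as competitors for the cardinality optimum.

  d-least : ∀ {k x y} → Walk k x y → d x y ≤ᴺ k
  d-least {k} {x} {y} = proj₂ (proj₂ (least (λ k → walk? k x y) (Star⇒Walk (connected x y)))) k

  -- A path inside `S` shortens to a walk with fewer than `∣ S ∣` edges, and this walk lives in the
  -- whole graph, where `d` is measured.
  d<∣S∣ : ∀ {S} → InducesConnected S → ∀ {x y} → x ∈ S → y ∈ S → d x y ℕ.< ∣ S ∣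
  d<∣S∣ conn x∈S y∈S = let k , ws , k<∣S∣ = StarIn⇒Walk x∈S (conn x∈S y∈S)
                       in ℕ.≤-<-trans (d-least ws) k<∣S∣

  h-≢ : ∀ T {x y} → x ≢ y → h T x y ≡ ∣ C T x y ∣ ∸ 1
  h-≢ T {x} {y} x≢y = if-no (x Fin.≟ y) x≢y

  ConnectedHierarchy⇒CardFeasible : ∀ T → ConnectedHierarchy T → CardFeasible T
  ConnectedHierarchy⇒CardFeasible T conn x y with x Fin.≟ y
  -- On the diagonal `h` is zero, and the empty walk gives distance zero.
  ... | yes ≡.refl = d-least []
  ... | no _       = ℕ.<⇒≤pred (d<∣S∣ (λ {u} {v} → AllClusters-C T conn x y {u} {v}) x∈C y∈C)
    where
    x∈C = proj₁ (∈C T ∈⊤ ∈⊤)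
    y∈C = proj₂ (∈C T ∈⊤ ∈⊤)

  -- `h` is given a special value only on the diagonal, and an edge joins distinct vertices.
  Σᴱ-h≈cost⁻ : ∀ T → Σᴱ (λ {x} {y} e → w e * fromℕ (h T x y)) ≈ cost⁻ T
  Σᴱ-h≈cost⁻ T = Σᴱ-cong _ _ λ e → *-congˡ (reflexive (≡.cong fromℕ (h-≢ T (~⇒≢ e))))

  OPT-card≤cost⁻ : ∀ {v} → IsOPT-card v → ∀ T → ConnectedHierarchy T → v ≤ cost⁻ T
  OPT-card≤cost⁻ (_ , minimal) T conn cost⁻<v =
    minimal T (ConnectedHierarchy⇒CardFeasible T conn) (<-respˡ-≈ (sym (Σᴱ-h≈cost⁻ T)) cost⁻<v)

  -- Clearing the denominator leaves `optCard` to be compared with the expectation times `optFree`;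
  -- as `optFree` equals `F T`, that product is `cost⁻ T`.
  OPT-card/OPT-free≤𝔼 : ∀ T → ConnectedHierarchy T →
    ∀ optFree optCard (isFree : IsOPT-free optFree) → IsOPT-card optCard → F T ≈ optFree →
    optCard / optFree ⟨ OPT-free-pos isFree ⟩ ≤ 𝔼 T (μ T) (ρ T)
  OPT-card/OPT-free≤𝔼 T conn optFree optCard isFree isCard F≈optFree =
    x≤q*y⇒x/y≤q (OPT-free-pos isFree) λ 𝔼*optFree<optCard →
      OPT-card≤cost⁻ isCard T conn
        (<-respˡ-≈ (sym (trans (cost⁻≈𝔼*F T) (*-congˡ F≈optFree))) 𝔼*optFree<optCard)

lemma17 :
    ∀ {c ℓ₁ ℓ₂} (ℝ : Reals c ℓ₁ ℓ₂) {n : ℕ} (2≤n : 2 ≤ᴺ n)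
      (G : WeightedGraph ℝ n) (connected : WeightedGraph.Connected G) →
    let open Reals ℝ
        open Clustering ℝ 2≤n G connected
    in
    (∀ (T : Hierarchy (⊤ {n})) → ConnectedHierarchy T →
       (cost⁻ T / F T ⟨ F-pos T ⟩ ≈ Σᴵ T (λ S → μ T S * ρ T S)) ×
       (Σᴵ T (λ S → μ T S * ρ T S) ≈ 𝔼 T (μ T) (ρ T))) ×
    (∀ (T⋆ : Hierarchy (⊤ {n})) → ConnectedHierarchy T⋆ →
     ∀ optFree optCard (isFree : IsOPT-free optFree) → IsOPT-card optCard →
       F T⋆ ≈ optFree →
       optCard / optFree ⟨ OPT-free-pos isFree ⟩ ≤ 𝔼 T⋆ (μ T⋆) (ρ T⋆))
lemma17 ℝ 2≤n G connected =
  -- `𝔼` unfolds to the middle sum, so the second equality is reflexivity.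
  (λ T _ → x≈q*y⇒x/y≈q (F-pos T) (cost⁻≈𝔼*F T) , refl) , OPT-card/OPT-free≤𝔼
  where
  open Reals ℝ using (refl)
  open Clustering ℝ 2≤n G connected using (F-pos)
  open RealProperties ℝ using (x≈q*y⇒x/y≈q)
  open ClusteringProperties ℝ 2≤n G connected using (cost⁻≈𝔼*F; OPT-card/OPT-free≤𝔼)
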